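{- There is no $o\!\left(\frac{n}{\sum_{i=1}^n a_i}\right)$ time randomized approximation scheme algorithm for the sum problem.
   Context: The sum problem: given a list of nonnegative real numbers $a_1,\ldots,a_n$, approximate the sum $\sum_{i=1}^n a_i$. For a real number $\epsilon\ge 0$, a real number $s$ is a $(1+\epsilon)$-approximation for the sum problem $a_1,\ldots,a_n$ if $\frac{1}{1+\epsilon}\sum_{i=1}^n a_i\le s\le (1+\epsilon)\sum_{i=1}^n a_i$. An approximation scheme is understood in the usual sense: it provides a $(1+\epsilon)$-approximation for every constant $\epsilon>0$. In the randomized model considered, the input list is accessed by uniform random sampling, which selects one element of the list with equal probability each time. -}

module Defs where

open import Level using (Level; _⊔_) renaming (suc to lsuc)
open import Algebra.Apartness.Bundles using (HeytingField; HeytingCommutativeRing)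
open import Algebra.Bundles using (CommutativeRing)
import Algebra.Definitions
import Algebra.Definitions.RawMonoid as RawMonoidDefinitions
open import Data.Empty using (⊥-elim)
open import Data.Fin.Base using (Fin)
open import Data.Integer.Base using (+_)
open import Data.Nat.Base as ℕ using (ℕ; zero; suc; NonZero)
open import Data.Product.Base using (∃-syntax; _×_; _,_; proj₁; proj₂)
open import Data.Rational.Base as ℚ using (ℚ; 0ℚ; 1ℚ)
open import Data.Sum.Base using (_⊎_; inj₁; inj₂)
open import Data.Vec.Functional using (Vector)
open import Relation.Binary.Core using (Rel)
open import Relation.Binary.PropositionalEquality.Core using (_≡_)
open import Relation.Binary.Structures using (IsStrictPartialOrder)
open import Relation.Nullary.Negation.Core using (¬_)
open import Relation.Unary using (Pred)

-- The real numbers, given by their characterisation as a Cauchy-complete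
-- Archimedean ordered field.  Decidability of the order is not required, so
-- both classical and constructive constructions of ℝ are models.

record Reals (c ℓ₁ ℓ₂ : Level) : Set (lsuc (c ⊔ ℓ₁ ⊔ ℓ₂)) where
  field
    heytingField : HeytingField c ℓ₁ ℓ₂

  open HeytingField heytingField public
  open HeytingCommutativeRing heytingCommutativeRing public using (commutativeRing)
  open RawMonoidDefinitions (CommutativeRing.+-rawMonoid commutativeRing) public
    using (sum) renaming (_×_ to _·_)
  open Algebra.Definitions _≈_ using (Invertible)

  infix 4 _<_ _≤_

  field
    _<_                  : Rel Carrier ℓ₂
    isStrictPartialOrder : IsStrictPartialOrder _≈_ _<_
    <⇒#                  : ∀ {x y} → x < y → x # y
    #⇒<⊎>                : ∀ {x y} → x # y → x < y ⊎ y < x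
    0<1                  : 0# < 1#
    +-monoʳ-<            : ∀ z {x y} → x < y → z + x < z + y
    *-pos                : ∀ {x y} → 0# < x → 0# < y → 0# < x * y
    archimedean          : ∀ x → ∃[ n ] x < n · 1#

  private module < = IsStrictPartialOrder isStrictPartialOrder

  ∣_-_∣<_ : Carrier → Carrier → Carrier → Set ℓ₂
  ∣ x - y ∣< δ = x - y < δ × y - x < δ

  field
    complete : (u : ℕ → Carrier) →
      (∀ δ → 0# < δ → ∃[ N ] ∀ m n → N ℕ.≤ m → N ℕ.≤ n → ∣ u m - u n ∣< δ) →
      ∃[ l ] ∀ δ → 0# < δ → ∃[ N ] ∀ n → N ℕ.≤ n → ∣ u n - l ∣< δ

  _≤_ : Rel Carrier ℓ₂
  x ≤ y = ¬ (y < x)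

  fromℕ : ℕ → Carrier
  fromℕ n = n · 1#

  <⇒≤ : ∀ {x y} → x < y → x ≤ y
  <⇒≤ x<y y<x = <.irrefl refl (<.trans x<y y<x)

  positive⇒invertible : ∀ {x} → 0# < x → Invertible 1# _*_ x
  positive⇒invertible {x} 0<x with #⇒invertible (#-sym (<⇒# 0<x))
  ... | y , yx≈1 , xy≈1 = y , trans (*-congˡ (sym x-0≈x)) yx≈1 , trans (*-congʳ (sym x-0≈x)) xy≈1
    where
    x-0≈x : x - 0# ≈ x
    x-0≈x = trans (+-congˡ (trans (sym (+-identityˡ (- 0#))) (-‿inverseʳ 0#))) (+-identityʳ x)

  infixl 7 _/_⟨_⟩

  _/_⟨_⟩ : Carrier → ∀ y → 0# < y → Carrier
  x / y ⟨ 0<y ⟩ = x * proj₁ (positive⇒invertible 0<y)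

  1+-positive : ∀ {x} → 0# ≤ x → 0# < 1# + x
  1+-positive {x} 0≤x with #-cotrans (<⇒# 0<1) (1# + x)
  ... | inj₁ 0#1+x with #⇒<⊎> 0#1+x
  ...   | inj₁ 0<1+x = 0<1+x
  ...   | inj₂ 1+x<0 = ⊥-elim (1+x≮1 (<.trans 1+x<0 0<1))
    where
    1+x≮1 : ¬ (1# + x < 1#)
    1+x≮1 p = 0≤x (<.<-respˡ-≈ (trans (sym (+-assoc (- 1#) 1# x))
                     (trans (+-congʳ (-‿inverseˡ 1#)) (+-identityˡ x)))
                   (<.<-respʳ-≈ (-‿inverseˡ 1#) (+-monoʳ-< (- 1#) p)))
  1+-positive {x} 0≤x | inj₂ 1+x#1 with #⇒<⊎> 1+x#1
  ...   | inj₂ 1<1+x = <.trans 0<1 1<1+x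
  ...   | inj₁ 1+x<1 = ⊥-elim (0≤x (<.<-respˡ-≈ (trans (sym (+-assoc (- 1#) 1# x))
                     (trans (+-congʳ (-‿inverseˡ 1#)) (+-identityˡ x)))
                   (<.<-respʳ-≈ (-‿inverseˡ 1#) (+-monoʳ-< (- 1#) 1+x<1))))

mean : ∀ {n} .{{_ : NonZero n}} → Vector ℚ n → ℚ
mean {n} q = (+ 1 ℚ./ n) ℚ.* sumℚ q
  where open RawMonoidDefinitions ℚ.+-0-rawMonoid renaming (sum to sumℚ)

module _ {c ℓ₁ ℓ₂} (ℝ : Reals c ℓ₁ ℓ₂) where
  open Reals ℝ

  NonNegative : ∀ {n} → Pred (Vector Carrier n) ℓ₂
  NonNegative a = ∀ i → 0# ≤ a i

  IsApproximation : ∀ {n} (ε : Carrier) → 0# ≤ ε → Vector Carrier n → Pred Carrier ℓ₂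
  IsApproximation ε 0≤ε a s =
    (1# / (1# + ε) ⟨ 1+-positive 0≤ε ⟩) * sum a ≤ s × s ≤ (1# + ε) * sum a

  -- A step of a computation: stop with an output, receive a uniformly random
  -- element of the input list, or use internal randomness (a uniform choice
  -- among finitely many successors; a single successor is a deterministic step).

  data Action (State : Set c) : Set c where
    halt   : Carrier → Action State
    sample : (Carrier → State) → Action State
    toss   : ∀ {k} .{{_ : NonZero k}} → (Fin k → State) → Action State

  -- The input list is reachable only through `sample`; its length is given at
  -- the start.  There is no computability restriction on `step`, so any
  -- implementation of a sampling algorithm is an instance.

  record Algorithm : Set (lsuc c) where
    field
      State : Set c
      start : ℕ → State
      step  : State → Action State

  module _ (A : Algorithm) {n} .{{_ : NonZero n}} (a : Vector Carrier n)
           {ℓ} (E : Pred Carrier ℓ) where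
    open Algorithm A

    -- `Mass t σ q` selects, among the runs from σ on the list a that halt within
    -- t steps, some whose outputs all satisfy E, and q is their exact total
    -- probability.  Hence Pr[halt within t steps with output in E] ≥ p iff some
    -- q ≥ p has `Mass t σ q`; this needs no decidability of E.

    data Mass : ℕ → State → ℚ → Set (c ⊔ ℓ) where
      none    : ∀ {t σ} → Mass t σ 0ℚ
      halts   : ∀ {t σ s} → step σ ≡ halt s → E s → Mass t σ 1ℚ
      samples : ∀ {t σ f} (q : Vector ℚ n) → step σ ≡ sample f →
                (∀ i → Mass t (f (a i)) (q i)) → Mass (suc t) σ (mean q)
      tosses  : ∀ {t σ k} .{{_ : NonZero k}} {f : Fin k → State} (q : Vector ℚ k) →
                step σ ≡ toss f →
                (∀ j → Mass t (f j) (q j)) → Mass (suc t) σ (mean q)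

    Pr[HaltsWithin_]≥_ : ℕ → ℚ → Set (c ⊔ ℓ)
    Pr[HaltsWithin t ]≥ p = ∃[ q ] p ℚ.≤ q × Mass t (start n) q

  TimeBound : Set c
  TimeBound = ∀ n → Vector Carrier n → ℕ

  -- One algorithm for each constant ε, with its own time bound, which may depend
  -- on the whole input list.  With probability at least p the run both respects
  -- the time bound and outputs a (1+ε)-approximation.

  record RandomizedApproximationScheme (p : ℚ) : Set (lsuc c ⊔ ℓ₂) where
    field
      algorithm : ∀ ε → 0# < ε → Algorithm
      time      : ∀ ε → 0# < ε → TimeBound
      correct   : ∀ ε (0<ε : 0# < ε) n .{{_ : NonZero n}} (a : Vector Carrier n) →
                  NonNegative a →
                  Pr[HaltsWithin_]≥_ (algorithm ε 0<ε) a
                    (IsApproximation ε (<⇒≤ 0<ε) a) (time ε 0<ε n a) p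

  -- T = o(n / Σ aᵢ) as n and n / Σ aᵢ both tend to infinity.  The bound is required
  -- only in this regime: uniformly in all lists it would force T = 0 on lists with
  -- Σ aᵢ ≥ n, so that no algorithm could meet it for trivial reasons.

  _∈o[n/Σ] : TimeBound → Set (c ⊔ ℓ₂)
  T ∈o[n/Σ] = ∀ C → 0# < C → ∃[ N ] ∀ n → N ℕ.≤ n → (a : Vector Carrier n) →
    NonNegative a → (0<Σ : 0# < sum a) →
    fromℕ N ≤ fromℕ n / sum a ⟨ 0<Σ ⟩ →
    fromℕ (T n a) ≤ C * (fromℕ n / sum a ⟨ 0<Σ ⟩)

{-# OPTIONS --safe #-}

-- Take two lists that vanish off index 0 and whose sums are so far apart (K and
-- more than (1+ε)² K) that no number approximates both.  A run of t steps on a list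
-- of length n tells them apart only if it samples index 0, which has probability at
-- most t/n, so the two success probabilities add up to at most 1 + t/n.  As the first
-- list has sum K, an o(n/Σ) time bound gives t ≤ n/K for large n, so the success
-- probability p satisfies 2p ≤ 1 + 1/K; this fails for large K when p > ½.
module Submission where

open import Defs
open import Algebra.Bundles using (CommutativeRing)
import Algebra.Properties.CommutativeMonoid.Sum as CommutativeMonoidSum
import Algebra.Properties.Ring as RingProperties
import Algebra.Properties.Semiring.Mult as SemiringMult
open import Data.Fin.Base using (zero; suc)
open import Data.Integer.Base as ℤ using (+_; +[1+_])
import Data.Integer.Properties as ℤ
open import Data.Integer.Tactic.RingSolver using (solve-∀)
open import Data.Nat.Base as ℕ using (ℕ; zero; suc; NonZero; s≤s)
import Data.Nat.Properties as ℕ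
open import Data.Product.Base using (∃-syntax; Σ-syntax; _,_; proj₁; proj₂)
open import Data.Rational.Base as ℚ using (ℚ; mkℚ; 0ℚ; ½; 1ℚ; toℚᵘ; _<_)
import Data.Rational.Properties as ℚ
open import Data.Rational.Unnormalised.Base as ℚᵘ using (mkℚᵘ; *≡*; *≤*; *<*)
import Data.Rational.Unnormalised.Properties as ℚᵘ
open import Data.Sum.Base using (inj₁; inj₂)
open import Data.Vec.Functional using (Vector; replicate) renaming (_∷_ to _∷ᵛ_)
open import Function.Base using (_∘_; case_of_)
open import Relation.Binary.PropositionalEquality as ≡ using (_≡_)
import Relation.Binary.Reasoning.Setoid as SetoidReasoning
open import Relation.Binary.Structures using (IsStrictPartialOrder)
open import Relation.Nullary.Negation.Core using (¬_; contradiction)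
open import Relation.Unary using (Pred)

-- Rational arithmetic: unit fractions and means.

private
  open module Sumℚ = CommutativeMonoidSum ℚ.+-0-commutativeMonoid
    using () renaming (sum to sumℚ)
  open module Multℚ = SemiringMult (CommutativeRing.semiring ℚ.+-*-commutativeRing)
    using () renaming (_×_ to _·ℚ_)

1/_ : ∀ n .{{_ : NonZero n}} → ℚ
1/ n = + 1 ℚ./ n

-- Normalised fractions hide the numerator of t/(m+1) behind a gcd. Passing to unnormalised
-- rationals exposes it, so that later comparisons become cross-multiplication of integers.
toℚᵘ-·1/ : ∀ t m → toℚᵘ (t ·ℚ 1/ suc m) ℚᵘ.≃ mkℚᵘ (+ t) m
toℚᵘ-·1/ zero    m = *≡* ≡.refl
toℚᵘ-·1/ (suc t) m = begin
  toℚᵘ (1/ suc m ℚ.+ t ·ℚ 1/ suc m)            ≈⟨ ℚ.toℚᵘ-homo-+ (1/ suc m) (t ·ℚ 1/ suc m) ⟩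
  toℚᵘ (1/ suc m) ℚᵘ.+ toℚᵘ (t ·ℚ 1/ suc m)    ≈⟨ ℚᵘ.+-cong (ℚ.toℚᵘ-fromℚᵘ (mkℚᵘ (+ 1) m)) (toℚᵘ-·1/ t m) ⟩
  mkℚᵘ (+ 1) m ℚᵘ.+ mkℚᵘ (+ t) m               ≈⟨ *≡* (common-denominator (+ t) (+ suc m)) ⟩
  mkℚᵘ (+ suc t) m                             ∎
  where
  open SetoidReasoning ℚᵘ.≃-setoid
  common-denominator : ∀ x d → (+ 1 ℤ.* d ℤ.+ x ℤ.* d) ℤ.* d ≡ (+ 1 ℤ.+ x) ℤ.* (d ℤ.* d)
  common-denominator = solve-∀

n·1/n≡1 : ∀ n .{{_ : NonZero n}} → n ·ℚ 1/ n ≡ 1ℚ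
n·1/n≡1 (suc m) = ℚ.toℚᵘ-injective (ℚᵘ.≃-trans (toℚᵘ-·1/ (suc m) m) (*≡* (ℤ.*-comm (+ suc m) (+ 1))))

m*k≤n⇒m·1/n≤1/k : ∀ m n k .{{_ : NonZero n}} .{{_ : NonZero k}} →
                  m ℕ.* k ℕ.≤ n → m ·ℚ 1/ n ℚ.≤ 1/ k
m*k≤n⇒m·1/n≤1/k m (suc n) (suc k) mk≤n = ℚ.toℚᵘ-cancel-≤ (begin
  toℚᵘ (m ·ℚ 1/ suc n)  ≃⟨ toℚᵘ-·1/ m n ⟩
  mkℚᵘ (+ m) n          ≤⟨ *≤* cross ⟩
  mkℚᵘ (+ 1) k          ≃⟨ ℚ.toℚᵘ-fromℚᵘ (mkℚᵘ (+ 1) k) ⟨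
  toℚᵘ (1/ suc k)       ∎)
  where
  open ℚᵘ.≤-Reasoning
  cross : + m ℤ.* + suc k ℤ.≤ + 1 ℤ.* + suc n
  cross = ≡.subst₂ ℤ._≤_ (ℤ.pos-* m (suc k)) (≡.sym (ℤ.*-identityˡ (+ suc n))) (ℤ.+≤+ mk≤n)

1/n-nonNegative : ∀ n .{{_ : NonZero n}} → ℚ.NonNegative (1/ n)
1/n-nonNegative n = ℚ.normalize-nonNeg 1 n

∃1/k< : ∀ {r} → 0ℚ < r → ∃[ k ] 1/ suc k < r
∃1/k< {r} 0<r = positive r (ℚ.positive 0<r)
  where
  positive : ∀ r → ℚ.Positive r → ∃[ k ] 1/ suc k < r
  -- Here `r` is (a+1)/(d+1), and the witness `suc d` stands for the fraction 1/(d+2). The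
  -- denominator is one larger than that of `r` so that the inequality is strict even when `a` is 0.
  positive r@(mkℚ +[1+ a ] d _) _ = suc d , ℚ.toℚᵘ-cancel-< (ℚᵘ.<-respˡ-≃
    (ℚᵘ.≃-sym (ℚ.toℚᵘ-fromℚᵘ (mkℚᵘ (+ 1) (suc d))))
    (*<* (≡.subst (ℤ._< +[1+ a ] ℤ.* +[1+ suc d ]) (≡.sym (ℤ.*-identityˡ +[1+ d ]))
      (ℤ.+<+ (ℕ.m≤m+n (suc (suc d)) (a ℕ.* suc (suc d)))))))

∃1/k-gap : ∀ {q p} → q < p → ∃[ k ] q ℚ.+ 1/ suc k < p
∃1/k-gap {q} {p} q<p with ∃1/k< (≡.subst (_< p ℚ.- q) (ℚ.+-inverseʳ q) (ℚ.+-monoˡ-< (ℚ.- q) q<p))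
... | k , 1/k<p-q = k , (begin-strict
  q ℚ.+ 1/ suc k       <⟨ ℚ.+-monoʳ-< q 1/k<p-q ⟩
  q ℚ.+ (p ℚ.- q)      ≡⟨ ≡.cong (q ℚ.+_) (ℚ.+-comm p (ℚ.- q)) ⟩
  q ℚ.+ (ℚ.- q ℚ.+ p)  ≡⟨ ℚ.+-assoc q (ℚ.- q) p ⟨
  q ℚ.- q ℚ.+ p        ≡⟨ ≡.cong (ℚ._+ p) (ℚ.+-inverseʳ q) ⟩
  0ℚ ℚ.+ p             ≡⟨ ℚ.+-identityˡ p ⟩
  p                    ∎)
  where open ℚ.≤-Reasoning

sum-mono-≤ : ∀ {n} {f g : Vector ℚ n} → (∀ i → f i ℚ.≤ g i) → sumℚ f ℚ.≤ sumℚ g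
sum-mono-≤ {zero}  f≤g = ℚ.≤-refl
sum-mono-≤ {suc n} f≤g = ℚ.+-mono-≤ (f≤g zero) (sum-mono-≤ (f≤g ∘ suc))

module _ {n} .{{_ : NonZero n}} where

  mean-mono-≤ : {f g : Vector ℚ n} → (∀ i → f i ℚ.≤ g i) → mean f ℚ.≤ mean g
  mean-mono-≤ f≤g = ℚ.*-monoˡ-≤-nonNeg (1/ n) {{1/n-nonNegative n}} (sum-mono-≤ f≤g)

  mean-+ : (f g : Vector ℚ n) → mean (λ i → f i ℚ.+ g i) ≡ mean f ℚ.+ mean g
  mean-+ f g = ≡.trans (≡.cong (1/ n ℚ.*_) (Sumℚ.∑-distrib-+ f g))
                       (ℚ.*-distribˡ-+ (1/ n) (sumℚ f) (sumℚ g))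

  mean-replicate : ∀ c → mean (replicate n c) ≡ c
  mean-replicate c = begin
    1/ n ℚ.* sumℚ (replicate n c)  ≡⟨ ≡.cong (1/ n ℚ.*_) (Sumℚ.sum-replicate n) ⟩
    1/ n ℚ.* (n ·ℚ c)              ≡⟨ Multℚ.×-comm-* n (1/ n) c ⟩
    n ·ℚ (1/ n ℚ.* c)              ≡⟨ Multℚ.×-assoc-* n (1/ n) c ⟨
    (n ·ℚ 1/ n) ℚ.* c              ≡⟨ ≡.cong (ℚ._* c) (n·1/n≡1 n) ⟩
    1ℚ ℚ.* c                       ≡⟨ ℚ.*-identityˡ c ⟩
    c                              ∎
    where open ≡.≡-Reasoning

  mean-≤ : ∀ {f : Vector ℚ n} {c} → (∀ i → f i ℚ.≤ c) → mean f ℚ.≤ c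
  mean-≤ {f} {c} f≤c = ≡.subst (mean f ℚ.≤_) (mean-replicate c) (mean-mono-≤ f≤c)

-- The bound exceeds `c` by the indicator `e` of index 0, whose mean is the probability that a
-- uniform sample hits that index.
mean-≤-off-zero : ∀ {m} {f : Vector ℚ (suc m)} {c} → f zero ℚ.≤ c ℚ.+ 1ℚ →
                  (∀ i → f (suc i) ℚ.≤ c) → mean f ℚ.≤ c ℚ.+ 1/ suc m
mean-≤-off-zero {m} {f} {c} f₀≤ f₊≤ = begin
  mean f                                  ≤⟨ mean-mono-≤ bound ⟩
  mean (λ i → c ℚ.+ e i)                  ≡⟨ mean-+ (replicate (suc m) c) e ⟩
  mean (replicate (suc m) c) ℚ.+ mean e   ≡⟨ ≡.cong₂ ℚ._+_ (mean-replicate {suc m} c) mean-e ⟩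
  c ℚ.+ 1/ suc m                          ∎
  where
  open ℚ.≤-Reasoning
  e : Vector ℚ (suc m)
  e = 1ℚ ∷ᵛ replicate m 0ℚ
  bound : ∀ i → f i ℚ.≤ c ℚ.+ e i
  bound zero    = f₀≤
  bound (suc i) = ≡.subst (f (suc i) ℚ.≤_) (≡.sym (ℚ.+-identityʳ c)) (f₊≤ i)
  mean-e : mean e ≡ 1/ suc m
  mean-e = ≡.trans (≡.cong (λ s → 1/ suc m ℚ.* (1ℚ ℚ.+ s)) (Sumℚ.sum-replicate-zero m))
                   (ℚ.*-identityʳ (1/ suc m))

-- Coupled runs on two lists that agree off index 0.

module _ {c ℓ₁ ℓ₂} (ℝ : Reals c ℓ₁ ℓ₂) (A : Algorithm ℝ) where
  open Reals ℝ using (Carrier)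
  open Algorithm A

  mass-≤1 : ∀ {n} .{{_ : NonZero n}} {a : Vector Carrier n} {ℓ} {E : Pred Carrier ℓ} {t σ q} →
            Mass ℝ A a E t σ q → q ℚ.≤ 1ℚ
  mass-≤1 none           = ℚ.nonNegative⁻¹ 1ℚ
  mass-≤1 (halts _ _)    = ℚ.≤-refl
  mass-≤1 (samples _ _ M) = mean-≤ λ i → mass-≤1 (M i)
  mass-≤1 (tosses _ _ M)  = mean-≤ λ j → mass-≤1 (M j)

  -- Run on a and b with shared randomness: the two computations agree, and so
  -- count at most once, until index 0 is sampled, which has probability 1/n per step.
  module _ {m} {a b : Vector Carrier (suc m)} (a₊≡b₊ : ∀ i → a (suc i) ≡ b (suc i))
           {ℓ ℓ′} {E : Pred Carrier ℓ} {F : Pred Carrier ℓ′} (disjoint : ∀ {s} → E s → ¬ F s) where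

    private
      bound : ℕ → ℚ
      bound t = 1ℚ ℚ.+ t ·ℚ 1/ suc m

      1≤bound : ∀ t → 1ℚ ℚ.≤ bound t
      bound≤bound-suc : ∀ t → bound t ℚ.≤ bound (suc t)
      bound+1/n≡bound-suc : ∀ t → bound t ℚ.+ 1/ suc m ≡ bound (suc t)

      1≤bound zero    = ℚ.≤-refl
      1≤bound (suc t) = ℚ.≤-trans (1≤bound t) (bound≤bound-suc t)

      bound+1/n≡bound-suc t = ≡.trans (ℚ.+-assoc 1ℚ (t ·ℚ 1/ suc m) (1/ suc m))
                                      (≡.cong (1ℚ ℚ.+_) (ℚ.+-comm (t ·ℚ 1/ suc m) (1/ suc m)))

      bound≤bound-suc t = begin
        bound t               ≡⟨ ℚ.+-identityʳ (bound t) ⟨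
        bound t ℚ.+ 0ℚ        ≤⟨ ℚ.+-monoʳ-≤ (bound t)
                                   (ℚ.nonNegative⁻¹ (1/ suc m) {{1/n-nonNegative (suc m)}}) ⟩
        bound t ℚ.+ 1/ suc m  ≡⟨ bound+1/n≡bound-suc t ⟩
        bound (suc t)         ∎
        where open ℚ.≤-Reasoning

    -- Simultaneous induction on both derivations, which start from the same state. The bound
    -- involves `t` but not `u`: once the first derivation gives up with `none`, the second
    -- contributes at most 1 however long it runs. So only the time on `a` has to be controlled.
    mass-disjoint : ∀ {t u σ p q} → Mass ℝ A a E t σ p → Mass ℝ A b F u σ q →
                    p ℚ.+ q ℚ.≤ 1ℚ ℚ.+ t ·ℚ 1/ suc m
    mass-disjoint {t} {q = q} none N = begin
      0ℚ ℚ.+ q  ≡⟨ ℚ.+-identityˡ q ⟩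
      q         ≤⟨ mass-≤1 N ⟩
      1ℚ        ≤⟨ 1≤bound t ⟩
      bound t   ∎
      where open ℚ.≤-Reasoning
    mass-disjoint {t} {p = p} M none = begin
      p ℚ.+ 0ℚ  ≡⟨ ℚ.+-identityʳ p ⟩
      p         ≤⟨ mass-≤1 M ⟩
      1ℚ        ≤⟨ 1≤bound t ⟩
      bound t   ∎
      where open ℚ.≤-Reasoning
    mass-disjoint (halts eq Es) (halts eq′ Fs) with ≡.trans (≡.sym eq) eq′
    ... | ≡.refl = contradiction Fs (disjoint Es)
    mass-disjoint (halts eq _) (samples _ eq′ _) = case ≡.trans (≡.sym eq) eq′ of λ ()
    mass-disjoint (halts eq _) (tosses _ eq′ _) = case ≡.trans (≡.sym eq) eq′ of λ ()
    mass-disjoint (samples _ eq _) (halts eq′ _) = case ≡.trans (≡.sym eq) eq′ of λ ()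
    mass-disjoint (samples _ eq _) (tosses _ eq′ _) = case ≡.trans (≡.sym eq) eq′ of λ ()
    mass-disjoint (tosses _ eq _) (halts eq′ _) = case ≡.trans (≡.sym eq) eq′ of λ ()
    mass-disjoint (tosses _ eq _) (samples _ eq′ _) = case ≡.trans (≡.sym eq) eq′ of λ ()
    mass-disjoint {suc t} {suc u} (samples {f = f} p eq M) (samples q eq′ N)
      with ≡.trans (≡.sym eq) eq′
    ... | ≡.refl = begin
      mean p ℚ.+ mean q         ≡⟨ mean-+ p q ⟨
      -- After index 0 the runs may separate, and only the trivial bound 1 on each mass is left. At
      -- every other index both lists supply the same value, hence the same successor state, and the
      -- induction hypothesis applies.
      mean (λ i → p i ℚ.+ q i)  ≤⟨ mean-≤-off-zero {f = λ i → p i ℚ.+ q i}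
                                     (ℚ.+-mono-≤ (ℚ.≤-trans (mass-≤1 (M zero)) (1≤bound t)) (mass-≤1 (N zero)))
                                     (λ i → mass-disjoint (M (suc i))
                                              (≡.subst (λ x → Mass ℝ A b F u (f x) (q (suc i)))
                                                       (≡.sym (a₊≡b₊ i)) (N (suc i)))) ⟩
      bound t ℚ.+ 1/ suc m      ≡⟨ bound+1/n≡bound-suc t ⟩
      bound (suc t)             ∎
      where open ℚ.≤-Reasoning
    mass-disjoint {suc t} (tosses p eq M) (tosses q eq′ N)
      with ≡.trans (≡.sym eq) eq′
    ... | ≡.refl = begin
      mean p ℚ.+ mean q         ≡⟨ mean-+ p q ⟨
      -- Both runs receive the same outcome `j`, so a toss never separates them and adds nothing to
      -- the bound.
      mean (λ i → p i ℚ.+ q i)  ≤⟨ mean-≤ (λ j → mass-disjoint (M j) (N j)) ⟩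
      bound t                   ≤⟨ bound≤bound-suc t ⟩
      bound (suc t)             ∎
      where open ℚ.≤-Reasoning

    pr-disjoint : ∀ {t u p q} → Pr[HaltsWithin_]≥_ ℝ A a E t p → Pr[HaltsWithin_]≥_ ℝ A b F u q →
                  p ℚ.+ q ℚ.≤ 1ℚ ℚ.+ t ·ℚ 1/ suc m
    pr-disjoint (_ , p≤p′ , M) (_ , q≤q′ , N) = ℚ.≤-trans (ℚ.+-mono-≤ p≤p′ q≤q′) (mass-disjoint M N)

-- Order and division in the real field.

module _ {c ℓ₁ ℓ₂} (ℝ : Reals c ℓ₁ ℓ₂) where
  open Reals ℝ renaming (_<_ to _<ℝ_)
  open IsStrictPartialOrder isStrictPartialOrder using (<-respˡ-≈; <-respʳ-≈)
    renaming (irrefl to <-irrefl; trans to <-trans)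
  open CommutativeRing commutativeRing using (ring; semiring; +-commutativeMonoid)
  open RingProperties ring using (-0#≈0#; [y-z]x≈yx-zx)
  open SemiringMult semiring using (×1-homo-*)
  open CommutativeMonoidSum +-commutativeMonoid using (sum-replicate-zero)

  private
    variable
      x y z : Carrier

  <-resp₂-≈ : ∀ {x x′ y y′} → x ≈ x′ → y ≈ y′ → x <ℝ y → x′ <ℝ y′
  <-resp₂-≈ x≈x′ y≈y′ x<y = <-respˡ-≈ x≈x′ (<-respʳ-≈ y≈y′ x<y)

  x+[y-x]≈y : ∀ x y → x + (y - x) ≈ y
  x+[y-x]≈y x y = begin
    x + (y - x)    ≈⟨ +-comm x (y - x) ⟩
    y - x + x      ≈⟨ +-assoc y (- x) x ⟩
    y + (- x + x)  ≈⟨ +-congˡ (-‿inverseˡ x) ⟩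
    y + 0#         ≈⟨ +-identityʳ y ⟩
    y              ∎
    where open SetoidReasoning setoid

  x<y⇒0<y-x : x <ℝ y → 0# <ℝ y - x
  x<y⇒0<y-x {x} {y} x<y = <-resp₂-≈ (-‿inverseˡ x) (+-comm (- x) y) (+-monoʳ-< (- x) x<y)

  0<y-x⇒x<y : 0# <ℝ y - x → x <ℝ y
  0<y-x⇒x<y {y} {x} 0<y-x = <-resp₂-≈ (+-identityʳ x) (x+[y-x]≈y x y) (+-monoʳ-< x 0<y-x)

  *-monoˡ-< : 0# <ℝ z → x <ℝ y → x * z <ℝ y * z
  *-monoˡ-< {z} {x} {y} 0<z x<y =
    0<y-x⇒x<y (<-respʳ-≈ ([y-z]x≈yx-zx z y x) (*-pos (x<y⇒0<y-x x<y) 0<z))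

  _⁻¹⟨_⟩ : ∀ x → 0# <ℝ x → Carrier
  x ⁻¹⟨ 0<x ⟩ = proj₁ (positive⇒invertible 0<x)

  *-inverseˡ : (0<x : 0# <ℝ x) → x ⁻¹⟨ 0<x ⟩ * x ≈ 1#
  *-inverseˡ 0<x = proj₁ (proj₂ (positive⇒invertible 0<x))

  *-inverseʳ : (0<x : 0# <ℝ x) → x * x ⁻¹⟨ 0<x ⟩ ≈ 1#
  *-inverseʳ 0<x = proj₂ (proj₂ (positive⇒invertible 0<x))

  ⁻¹-positive : (0<x : 0# <ℝ x) → 0# <ℝ x ⁻¹⟨ 0<x ⟩
  ⁻¹-positive {x} 0<x = case #⇒<⊎> x⁻¹#0 of λ where
      (inj₂ 0<x⁻¹) → 0<x⁻¹
      (inj₁ x⁻¹<0) → contradiction (1<0 x⁻¹<0) (<⇒≤ 0<1)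
    where
    x⁻¹ = x ⁻¹⟨ 0<x ⟩
    -- `invertible⇒#` obtains apartness from invertibility of a difference, so the inverse is
    -- rewritten as a difference from zero.
    x⁻¹-0≈x⁻¹ : x⁻¹ - 0# ≈ x⁻¹
    x⁻¹-0≈x⁻¹ = trans (+-congˡ -0#≈0#) (+-identityʳ x⁻¹)
    x⁻¹#0 : x⁻¹ # 0#
    x⁻¹#0 = invertible⇒# (x , trans (*-congˡ x⁻¹-0≈x⁻¹) (*-inverseʳ 0<x)
                            , trans (*-congʳ x⁻¹-0≈x⁻¹) (*-inverseˡ 0<x))
    1<0 : x⁻¹ <ℝ 0# → 1# <ℝ 0#
    1<0 x⁻¹<0 = <-resp₂-≈ (*-inverseˡ 0<x) (zeroˡ x) (*-monoˡ-< 0<x x⁻¹<0)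

  x/y*y≈x : ∀ x (0<y : 0# <ℝ y) → x / y ⟨ 0<y ⟩ * y ≈ x
  x/y*y≈x x 0<y = trans (*-assoc _ _ _) (trans (*-congˡ (*-inverseˡ 0<y)) (*-identityʳ x))

  x*y/y≈x : ∀ x (0<y : 0# <ℝ y) → (x * y) / y ⟨ 0<y ⟩ ≈ x
  x*y/y≈x x 0<y = trans (*-assoc _ _ _) (trans (*-congˡ (*-inverseʳ 0<y)) (*-identityʳ x))

  fromℕ-positive : ∀ n → 0# <ℝ fromℕ (suc n)
  fromℕ-positive zero    = <-respʳ-≈ (sym (+-identityʳ 1#)) 0<1
  fromℕ-positive (suc n) = <-trans 0<1 (<-respˡ-≈ (+-identityʳ 1#) (+-monoʳ-< 1# (fromℕ-positive n)))

  fromℕ-mono-< : ∀ {m n} → m ℕ.< n → fromℕ m <ℝ fromℕ n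
  fromℕ-mono-< {zero}  {suc n} _         = fromℕ-positive n
  fromℕ-mono-< {suc m} {suc n} (s≤s m<n) = +-monoʳ-< 1# (fromℕ-mono-< m<n)

  -- The conclusion lies in ℕ, where the order is decidable, so it suffices to refute n < mk. The
  -- divisor `y` is only `≈` to `fromℕ k` because it will be the sum of a list.
  m≤n/k⇒m*k≤n : ∀ m n k (0<y : 0# <ℝ y) → y ≈ fromℕ k →
                fromℕ m ≤ fromℕ n / y ⟨ 0<y ⟩ → m ℕ.* k ℕ.≤ n
  m≤n/k⇒m*k≤n {y} m n k 0<y y≈k m≤n/y = ℕ.≮⇒≥ λ n<mk → m≤n/y
    (<-respʳ-≈ (x*y/y≈x (fromℕ m) 0<y) (*-monoˡ-< (⁻¹-positive 0<y)
      (<-respʳ-≈ (trans (×1-homo-* m k) (*-congˡ (sym y≈k))) (fromℕ-mono-< n<mk))))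

  m*k<n⇒m≤n/k : ∀ m n k (0<y : 0# <ℝ y) → y ≈ fromℕ k →
                m ℕ.* k ℕ.< n → fromℕ m ≤ fromℕ n / y ⟨ 0<y ⟩
  m*k<n⇒m≤n/k {y} m n k 0<y y≈k mk<n n/y<m = <-irrefl refl (<-trans (fromℕ-mono-< mk<n)
    (<-resp₂-≈ (x/y*y≈x (fromℕ n) 0<y) (trans (*-congˡ y≈k) (sym (×1-homo-* m k)))
      (*-monoˡ-< 0<y n/y<m)))

  -- Since `≤` is a negation and the order may be undecidable, `z` cannot be compared with `x` and
  -- `y` directly. Cotransitivity of apartness separates `z` from one of them, and each resulting
  -- order contradicts a hypothesis.
  ≤-<-≤-contradiction : x <ℝ y → z ≤ x → ¬ (y ≤ z)
  ≤-<-≤-contradiction {x} {y} {z} x<y z≤x y≤z with #-cotrans (<⇒# x<y) z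
  ... | inj₁ x#z = case #⇒<⊎> x#z of λ where
    (inj₁ x<z) → z≤x x<z
    (inj₂ z<x) → y≤z (<-trans z<x x<y)
  ... | inj₂ z#y = case #⇒<⊎> z#y of λ where
    (inj₁ z<y) → y≤z z<y
    (inj₂ y<z) → z≤x (<-trans x<y y<z)

  -- Lists supported at index 0 and their approximations.

  spike : ∀ {m} → Carrier → Vector Carrier (suc m)
  spike {m} x = x ∷ᵛ replicate m 0#

  sum-spike : ∀ m x → sum (spike {m} x) ≈ x
  sum-spike m x = trans (+-congˡ (sum-replicate-zero m)) (+-identityʳ x)

  spike-nonNegative : ∀ {m} → 0# ≤ x → NonNegative ℝ (spike {m} x)
  spike-nonNegative 0≤x zero    = 0≤x
  spike-nonNegative 0≤x (suc i) = <-irrefl refl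

  module _ {ε} (0≤ε : 0# ≤ ε) where

    private
      1+ε = 1# + ε
      0<1+ε = 1+-positive 0≤ε

    -- Dividing by 1+ε leaves 1 + (1+ε)x, which exceeds every (1+ε)-approximation of x.
    far : Carrier → Carrier
    far x = 1+ε * (1# + 1+ε * x)

    far-positive : 0# <ℝ x → 0# <ℝ far x
    far-positive 0<x = *-pos 0<1+ε (1+-positive (<⇒≤ (*-pos 0<1+ε 0<x)))

    approximations-disjoint : ∀ {m x s} → IsApproximation ℝ ε 0≤ε (spike {m} x) s →
                              ¬ IsApproximation ℝ ε 0≤ε (spike {m} (far x)) s
    approximations-disjoint {m} {x} (_ , s≤) (≤s , _) = ≤-<-≤-contradiction
      (<-resp₂-≈ (*-congˡ (sym (sum-spike m x))) (sym lower) x<1+x) s≤ ≤s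
      where
      x<1+x : 1+ε * x <ℝ 1# + 1+ε * x
      x<1+x = <-resp₂-≈ (+-identityʳ _) (+-comm _ 1#) (+-monoʳ-< (1+ε * x) 0<1)
      lower : 1# / 1+ε ⟨ 0<1+ε ⟩ * sum (spike {m} (far x)) ≈ 1# + 1+ε * x
      lower = begin
        1# / 1+ε ⟨ 0<1+ε ⟩ * sum (spike {m} (far x))  ≈⟨ *-congˡ (sum-spike m (far x)) ⟩
        1# / 1+ε ⟨ 0<1+ε ⟩ * far x                    ≈⟨ *-assoc _ _ _ ⟨
        1# / 1+ε ⟨ 0<1+ε ⟩ * 1+ε * (1# + 1+ε * x)     ≈⟨ *-congʳ (x/y*y≈x 1# 0<1+ε) ⟩
        1# * (1# + 1+ε * x)                           ≈⟨ *-identityˡ _ ⟩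
        1# + 1+ε * x                                  ∎
        where open SetoidReasoning setoid

  -- The bound on the success probability.

  module _ {p} (S : RandomizedApproximationScheme ℝ p) where
    open RandomizedApproximationScheme S

    2p≤1+1/k : (∀ ε 0<ε → _∈o[n/Σ] ℝ (time ε 0<ε)) → ∀ k → p ℚ.+ p ℚ.≤ 1ℚ ℚ.+ 1/ suc k
    2p≤1+1/k fast k = ℚ.≤-trans 2p≤1+t/n (ℚ.+-monoʳ-≤ 1ℚ (m*k≤n⇒m·1/n≤1/k t (suc m) (suc k) t*k≤n))
      where
      0≤1 : 0# ≤ 1#
      0≤1 = <⇒≤ 0<1
      -- The first `1#` is the accuracy ε, the second the constant C of the little-o bound.
      o = fast 1# 0<1 1# 0<1
      N m : ℕ
      N = proj₁ o
      -- The length `suc m` is NK + 1: it is at least N, and the extra 1 gives the strict inequality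
      -- NK < n from which N ≤ n/Σ follows. Thus the list `a` lies in the regime where the little-o
      -- bound applies.
      m = N ℕ.* suc k
      K : Carrier
      K = fromℕ (suc k)
      0<K : 0# <ℝ K
      0<K = fromℕ-positive k
      a b : Vector Carrier (suc m)
      a = spike K
      b = spike (far 0≤1 K)
      Σa≈K : sum a ≈ K
      Σa≈K = sum-spike m K
      0<Σa : 0# <ℝ sum a
      0<Σa = <-respʳ-≈ (sym Σa≈K) 0<K
      a-nonNegative : NonNegative ℝ a
      a-nonNegative = spike-nonNegative (<⇒≤ 0<K)
      t : ℕ
      t = time 1# 0<1 (suc m) a

      t*k≤n : t ℕ.* suc k ℕ.≤ suc m
      t*k≤n = m≤n/k⇒m*k≤n t (suc m) (suc k) 0<Σa Σa≈K λ n/Σ<t →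
        proj₂ o (suc m) (ℕ.≤-trans (ℕ.m≤m*n N (suc k)) (ℕ.n≤1+n m)) a a-nonNegative 0<Σa
          (m*k<n⇒m≤n/k N (suc m) (suc k) 0<Σa Σa≈K ℕ.≤-refl)
          (<-respˡ-≈ (sym (*-identityˡ _)) n/Σ<t)

      2p≤1+t/n : p ℚ.+ p ℚ.≤ 1ℚ ℚ.+ t ·ℚ 1/ suc m
      2p≤1+t/n = pr-disjoint ℝ (algorithm 1# 0<1) {m} {a} {b} (λ _ → ≡.refl)
        (approximations-disjoint 0≤1 {m} {K})
        (correct 1# 0<1 (suc m) a a-nonNegative)
        (correct 1# 0<1 (suc m) b (spike-nonNegative (<⇒≤ (far-positive 0≤1 0<K))))

corollary2 : ∀ {c ℓ₁ ℓ₂} (ℝ : Reals c ℓ₁ ℓ₂) (p : ℚ) → ½ < p →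
    ¬ (Σ[ S ∈ RandomizedApproximationScheme ℝ p ]
    (∀ ε 0<ε → _∈o[n/Σ] ℝ (RandomizedApproximationScheme.time S ε 0<ε)))
corollary2 ℝ p ½<p (S , fast) =
  -- ½ + ½ evaluates to 1, so doubling ½ < p gives 1 < p + p. The index `k`, and with it K, is
  -- chosen from this gap.
  let k , 1+1/k<2p = ∃1/k-gap {1ℚ} (ℚ.+-mono-< ½<p ½<p)
  in  ℚ.<-irrefl ≡.refl (ℚ.<-≤-trans 1+1/k<2p (2p≤1+1/k ℝ S fast k))
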